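{- Let $r\ge1$ be an integer and, for integers $m\ge0$, let $S_{r,m}=\sum_{k=0}^{m}J_{rk}^{(3)}$. Define the $4\times4$ matrices $$A_{r}=\begin{pmatrix} 1&0&0&0\\ 1&2^{r}+\epsilon_{r}&-(2^{r}\epsilon_{r}+1)&2^{r}\\0&1&0&0\\ 0&0&1&0 \end{pmatrix},\quad Q_{r,n}=\begin{pmatrix} J_{r}^{(3)}+2^{r}J_{ -r}^{(3)}&0&0&0\\ S_{r,n}&J_{r(n+1)}^{(3)}&K_{r,n}^{(3)}&2^{r}J_{rn}^{(3)}\\S_{r,n-1}&J_{rn}^{(3)}&K_{r,n-1}^{(3)}&2^{r}J_{r(n-1)}^{(3)}\\ S_{r,n-2}&J_{r(n-1)}^{(3)}&K_{r,n-2}^{(3)}&2^{r}J_{r(n-2)}^{(3)} \end{pmatrix},$$ where $K_{r,m}^{(3)}=-(2^{r}\epsilon_{r}+1)J_{rm}^{(3)}+2^{r}J_{r(m-1)}^{(3)}$. Then for every integer $n\ge2$, $$J_{r}^{(3)}A_{r}^{n}+2^{r}J_{ -r}^{(3)}A_{r}^{n-1}=Q_{r,n}.$$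
   Context: The third order Jacobsthal numbers are defined by $J_0^{(3)}=0$, $J_1^{(3)}=J_2^{(3)}=1$ and $J_{n+3}^{(3)}=J_{n+2}^{(3)}+J_{n+1}^{(3)}+2J_n^{(3)}$ for $n\ge0$, and are extended to all negative indices by running the recurrence backwards, i.e. $J_{n}^{(3)}=\tfrac12\big(J_{n+3}^{(3)}-J_{n+2}^{(3)}-J_{n+1}^{(3)}\big)$ for all $n<0$ (so $J_{ -1}^{(3)}=0$, $J_{ -2}^{(3)}=\tfrac12$, $J_{ -3}^{(3)}=-\tfrac14$). Let $\omega_1=\frac{ -1+\sqrt{ -3}}{2}$, $\omega_2=\frac{ -1-\sqrt{ -3}}{2}$ be the roots of $x^2+x+1=0$ and $\epsilon_r=\omega_1^r+\omega_2^r$ (equal to $2$ if $3\mid r$, and $-1$ otherwise). -}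

module Defs where

open import Algebra.Bundles.Raw using (RawRing)
open import Data.Bool.Base using (if_then_else_)
open import Data.Fin.Base using (Fin; toℕ)
open import Data.Fin.Properties using (_≟_)
open import Data.Integer.Base as ℤ using (ℤ; +_; -[1+_])
open import Data.Nat.Base as ℕ using (ℕ; zero; suc)
open import Data.Rational.Base as ℚ using (ℚ; 0ℚ; 1ℚ; ½; -½)
open import Data.Vec.Functional using (Vector; []; _∷_)
open import Level using (0ℓ)
open import Relation.Binary.PropositionalEquality.Core using (_≡_)
open import Relation.Nullary.Decidable.Core using (does)

-- The field ℚ(√-3), which contains ω₁ and ω₂: the element a + b √-3 is the
-- pair (a , b). As ℚ is normalised, _≡_ is the right equality.
infix 5 _+_√-3
record ℚ[√-3] : Set where
  constructor _+_√-3
  field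
    rational   : ℚ
    irrational : ℚ

ℚ[√-3]-rawRing : RawRing 0ℓ 0ℓ
ℚ[√-3]-rawRing = record
  { Carrier = ℚ[√-3]
  ; _≈_     = _≡_
  ; _+_     = λ { (a + b √-3) (c + d √-3) → (a ℚ.+ c) + (b ℚ.+ d) √-3 }
  ; _*_     = λ { (a + b √-3) (c + d √-3) →
                  (a ℚ.* c ℚ.- (+ 3 ℚ./ 1) ℚ.* (b ℚ.* d))
                  + (a ℚ.* d ℚ.+ b ℚ.* c) √-3 }
  ; -_      = λ { (a + b √-3) → (ℚ.- a) + (ℚ.- b) √-3 }
  ; 0#      = 0ℚ + 0ℚ √-3
  ; 1#      = 1ℚ + 0ℚ √-3
  }

open RawRing ℚ[√-3]-rawRing public
  using (_+_; _*_; -_; 0#; 1#)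
open import Algebra.Definitions.RawSemiring (RawRing.rawSemiring ℚ[√-3]-rawRing) public
  using (_^_; sum)

ι : ℚ → ℚ[√-3]
ι q = q + 0ℚ √-3

2# : ℚ[√-3]
2# = ι (+ 2 ℚ./ 1)

ω₁ ω₂ : ℚ[√-3]
ω₁ = -½ + ½ √-3
ω₂ = -½ + -½ √-3

ε : ℕ → ℚ[√-3]
ε r = ω₁ ^ r + ω₂ ^ r

jacobsthal⁺ : ℕ → ℚ
jacobsthal⁺ 0 = 0ℚ
jacobsthal⁺ 1 = 1ℚ
jacobsthal⁺ 2 = 1ℚ
jacobsthal⁺ (suc (suc (suc n))) =
  jacobsthal⁺ (suc (suc n)) ℚ.+ jacobsthal⁺ (suc n) ℚ.+ (+ 2 ℚ./ 1) ℚ.* jacobsthal⁺ n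

-- jacobsthal⁻ k is the number with index 2 - k, so that the backward
-- recurrence J_n = ½ (J_{n+3} - J_{n+2} - J_{n+1}) is structural in k.
jacobsthal⁻ : ℕ → ℚ
jacobsthal⁻ 0 = jacobsthal⁺ 2
jacobsthal⁻ 1 = jacobsthal⁺ 1
jacobsthal⁻ 2 = jacobsthal⁺ 0
jacobsthal⁻ (suc (suc (suc k))) =
  ½ ℚ.* (jacobsthal⁻ k ℚ.- jacobsthal⁻ (suc k) ℚ.- jacobsthal⁻ (suc (suc k)))

jacobsthal : ℤ → ℚ
jacobsthal (+ n)    = jacobsthal⁺ n
jacobsthal -[1+ n ] = jacobsthal⁻ (3 ℕ.+ n)

J : ℤ → ℚ[√-3]
J i = ι (jacobsthal i)

S : ℕ → ℕ → ℚ[√-3]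
S r m = sum {suc m} λ k → J (+ r ℤ.* + toℕ k)

K : ℕ → ℤ → ℚ[√-3]
K r m = - (2# ^ r * ε r + 1#) * J (+ r ℤ.* m) + 2# ^ r * J (+ r ℤ.* (m ℤ.- + 1))

Matrix : ℕ → Set
Matrix d = Vector (Vector ℚ[√-3] d) d

infixl 6 _⊕_
infixl 7 _⊗_ _·_
infixr 8 _^ᴹ_

_⊕_ : ∀ {d} → Matrix d → Matrix d → Matrix d
(M ⊕ N) i j = M i j + N i j

_·_ : ∀ {d} → ℚ[√-3] → Matrix d → Matrix d
(c · M) i j = c * M i j

_⊗_ : ∀ {d} → Matrix d → Matrix d → Matrix d
(M ⊗ N) i j = sum λ k → M i k * N k j

𝟙 : ∀ {d} → Matrix d
𝟙 i j = if does (i ≟ j) then 1# else 0#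

_^ᴹ_ : ∀ {d} → Matrix d → ℕ → Matrix d
M ^ᴹ zero  = 𝟙
M ^ᴹ suc n = M ⊗ M ^ᴹ n

A : ℕ → Matrix 4
A r = (1# ∷ 0#           ∷ 0#                     ∷ 0#     ∷ [])
    ∷ (1# ∷ 2# ^ r + ε r ∷ - (2# ^ r * ε r + 1#) ∷ 2# ^ r ∷ [])
    ∷ (0# ∷ 1#           ∷ 0#                     ∷ 0#     ∷ [])
    ∷ (0# ∷ 0#           ∷ 1#                     ∷ 0#     ∷ [])
    ∷ []

-- Only meaningful for n ≥ 2, where the truncated subtractions indexing S are
-- exact; the indices of J and K may be negative and are integers.
Q : ℕ → ℕ → Matrix 4
Q r n =
    (J (+ r) + 2# ^ r * J (ℤ.- + r) ∷ 0# ∷ 0# ∷ 0# ∷ [])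
  ∷ (S r n         ∷ J (+ r ℤ.* (+ n ℤ.+ + 1)) ∷ K r (+ n)         ∷ 2# ^ r * J (+ r ℤ.* + n)           ∷ [])
  ∷ (S r (n ℕ.∸ 1) ∷ J (+ r ℤ.* + n)           ∷ K r (+ n ℤ.- + 1) ∷ 2# ^ r * J (+ r ℤ.* (+ n ℤ.- + 1)) ∷ [])
  ∷ (S r (n ℕ.∸ 2) ∷ J (+ r ℤ.* (+ n ℤ.- + 1)) ∷ K r (+ n ℤ.- + 2) ∷ 2# ^ r * J (+ r ℤ.* (+ n ℤ.- + 2)) ∷ [])
  ∷ []

{-# OPTIONS --safe #-}

-- With E the shift operator, E³ − E² − E − 2 = (E − 2)(E − ω₁)(E − ω₂) annihilates the
-- two-sided sequence J. As E − a divides Eʳ − aʳ and these operators commute,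
-- (Eʳ − 2ʳ)(Eʳ − ω₁ʳ)(Eʳ − ω₂ʳ) annihilates J too; since ω₁ω₂ = 1 this is a recurrence for
-- J_{rk} whose coefficients are the second row of A_r. Hence A_r Q_{r,n} = Q_{r,n+1}, the
-- first column following by summing the recurrence. The left-hand side obeys the same rule,
-- and both sides agree at n = 1, where the entry S_{r,−1} = 0 equals the truncated S_{r,0}.

module Submission where

open import Algebra.Bundles using (CommutativeRing)
import Algebra.Properties.CommutativeSemiring.Exp
import Algebra.Properties.Ring
import Algebra.Properties.Semiring.Exp
import Algebra.Properties.Semiring.Sum
import Algebra.Solver.Ring.NaturalCoefficients.Default
open import Data.Fin.Base using (Fin; zero; suc; toℕ)
open import Data.Fin.Patterns using (0F; 1F; 2F; 3F)
open import Data.Fin.Properties using (toℕ-inject₁; toℕ-fromℕ)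
open import Data.Integer.Base as ℤ using (ℤ; +_; -[1+_])
import Data.Integer.Properties as ℤ
import Data.Integer.Tactic.RingSolver as ℤ
open import Data.Nat.Base as ℕ using (ℕ; zero; suc; _≤_; _∸_)
import Data.Nat.Properties as ℕ
open import Data.Product.Base using (_,_)
open import Data.Rational.Base as ℚ using (ℚ; 0ℚ; 1ℚ; ½)
import Data.Rational.Properties as ℚ
import Data.Rational.Solver as ℚ
open import Data.Vec.Functional using (Vector)
open import Level using (0ℓ)
open import Relation.Binary.PropositionalEquality using (_≡_; cong; cong₂; module ≡-Reasoning)

-- Difference operators on two-sided sequences over a commutative ring.

module DifferenceOperators {c ℓ} (R : CommutativeRing c ℓ) where
  open CommutativeRing R
  open Algebra.Properties.Semiring.Exp semiring using (_^_)
  open Algebra.Properties.Ring ring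
  open Algebra.Solver.Ring.NaturalCoefficients.Default commutativeSemiring
  open import Relation.Binary.Reasoning.Setoid setoid

  -- Δ a s is Eˢ − a, where E is the shift of a two-sided sequence.
  Δ : Carrier → ℕ → (ℤ → Carrier) → ℤ → Carrier
  Δ a s f i = f (+ s ℤ.+ i) + - a * f i

  Δ-cong : ∀ a s {f g} → (∀ i → f i ≈ g i) → ∀ i → Δ a s f i ≈ Δ a s g i
  Δ-cong a s f≈g i = +-cong (f≈g _) (*-congˡ (f≈g i))

  Δ-comm : ∀ a s b t f i → Δ a s (Δ b t f) i ≈ Δ b t (Δ a s f) i
  Δ-comm a s b t f i = begin
    (f (+ t ℤ.+ (+ s ℤ.+ i)) + - b * f (+ s ℤ.+ i)) + - a * (f (+ t ℤ.+ i) + - b * f i)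
      ≡⟨ cong (λ j → (f j + - b * f (+ s ℤ.+ i)) + - a * (f (+ t ℤ.+ i) + - b * f i)) (swap (+ t) (+ s) i) ⟩
    (f (+ s ℤ.+ (+ t ℤ.+ i)) + - b * f (+ s ℤ.+ i)) + - a * (f (+ t ℤ.+ i) + - b * f i)
      ≈⟨ solve 6 (λ a b w x y z → (w :+ b :* x) :+ a :* (y :+ b :* z)
                               := (w :+ a :* y) :+ b :* (x :+ a :* z)) refl
           (- a) (- b) (f (+ s ℤ.+ (+ t ℤ.+ i))) (f (+ s ℤ.+ i)) (f (+ t ℤ.+ i)) (f i) ⟩
    (f (+ s ℤ.+ (+ t ℤ.+ i)) + - a * f (+ t ℤ.+ i)) + - b * (f (+ s ℤ.+ i) + - a * f i) ∎
    where
    swap : ∀ x y z → x ℤ.+ (y ℤ.+ z) ≡ y ℤ.+ (x ℤ.+ z)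
    swap = ℤ.solve-∀

  x≈y⇒x-y≈0 : ∀ {x y} → x ≈ y → x - y ≈ 0#
  x≈y⇒x-y≈0 {_} {y} x≈y = trans (+-congʳ x≈y) (-‿inverseʳ y)

  x-y≈0⇒x≈y : ∀ {x y} → x - y ≈ 0# → x ≈ y
  x-y≈0⇒x≈y {x} {y} x-y≈0 = begin
    x               ≈⟨ +-identityʳ x ⟨
    x + 0#          ≈⟨ +-congˡ (-‿inverseˡ y) ⟨
    x + (- y + y)   ≈⟨ +-assoc x (- y) y ⟨
    (x - y) + y     ≈⟨ +-congʳ x-y≈0 ⟩
    0# + y          ≈⟨ +-identityˡ y ⟩
    y               ∎

  -- E − a divides Eʳ − aʳ.
  Δ-power : ∀ {a f} → (∀ i → Δ a 1 f i ≈ 0#) → ∀ r i → Δ (a ^ r) r f i ≈ 0#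
  Δ-power {a} {f} Δf≈0 r i =
    trans (+-congˡ (sym (-‿distribˡ-* (a ^ r) (f i)))) (x≈y⇒x-y≈0 (geometric r i))
    where
    step : ∀ i → f (+ 1 ℤ.+ i) ≈ a * f i
    step i = x-y≈0⇒x≈y (trans (+-congˡ (-‿distribˡ-* a (f i))) (Δf≈0 i))

    geometric : ∀ r i → f (+ r ℤ.+ i) ≈ a ^ r * f i
    geometric zero i = begin
      f (+ 0 ℤ.+ i)  ≡⟨ cong f (ℤ.+-identityˡ i) ⟩
      f i            ≈⟨ *-identityˡ (f i) ⟨
      1# * f i       ∎
    geometric (suc r) i = begin
      f (+ suc r ℤ.+ i)          ≡⟨ cong f (ℤ.+-assoc (+ 1) (+ r) i) ⟩
      f (+ 1 ℤ.+ (+ r ℤ.+ i))    ≈⟨ step (+ r ℤ.+ i) ⟩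
      a * f (+ r ℤ.+ i)          ≈⟨ *-congˡ (geometric r i) ⟩
      a * (a ^ r * f i)         ≈⟨ *-assoc a (a ^ r) (f i) ⟨
      a * a ^ r * f i           ∎

  -- One rotation takes the outermost factor, replaces it by its r-th power version and moves it
  -- innermost. After three rotations every factor is replaced and the original order is restored.
  Δ³-power : ∀ {a b c f} → (∀ i → Δ a 1 (Δ b 1 (Δ c 1 f)) i ≈ 0#) →
             ∀ r i → Δ (a ^ r) r (Δ (b ^ r) r (Δ (c ^ r) r f)) i ≈ 0#
  Δ³-power eq r = power-rotate r (power-rotate r (power-rotate r eq))
    where
    -- The two other factors keep arbitrary steps `t` and `u`, so those already replaced are carried
    -- along unchanged.
    power-rotate : ∀ {a b t c u f} r → (∀ i → Δ a 1 (Δ b t (Δ c u f)) i ≈ 0#) →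
                   ∀ i → Δ b t (Δ c u (Δ (a ^ r) r f)) i ≈ 0#
    power-rotate {a} {b} {t} {c} {u} {f} r eq i = begin
      Δ b t (Δ c u (Δ (a ^ r) r f)) i ≈⟨ Δ-cong b t (Δ-comm c u (a ^ r) r f) i ⟩
      Δ b t (Δ (a ^ r) r (Δ c u f)) i ≈⟨ Δ-comm b t (a ^ r) r (Δ c u f) i ⟩
      Δ (a ^ r) r (Δ b t (Δ c u f)) i ≈⟨ Δ-power eq r i ⟩
      0#                               ∎

  -x*-y≈x*y : ∀ x y → - x * - y ≈ x * y
  -x*-y≈x*y x y = begin
    - x * - y       ≈⟨ -‿distribˡ-* x (- y) ⟨
    - (x * - y)     ≈⟨ -‿cong (-‿distribʳ-* x y) ⟨
    - - (x * y)     ≈⟨ -‿involutive (x * y) ⟩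
    x * y           ∎

  Δ³-expand : ∀ a b c s f i →
    Δ a s (Δ b s (Δ c s f)) i ≈
    f (+ s ℤ.+ (+ s ℤ.+ (+ s ℤ.+ i))) -
    ((a + (b + c)) * f (+ s ℤ.+ (+ s ℤ.+ i)) +
     (- (a * (b + c) + b * c) * f (+ s ℤ.+ i) + a * (b * c) * f i))
  Δ³-expand a b c s f i = begin
    Δ a s (Δ b s (Δ c s f)) i
      -- The solver knows only semirings, so `- a`, `- b`, `- c` enter as atoms. The signs are
      -- collected afterwards by `e₁`, `e₂`, `e₃`.
      ≈⟨ solve 7 (λ a b c x₀ x₁ x₂ x₃ →
           ((x₃ :+ c :* x₂) :+ b :* (x₂ :+ c :* x₁)) :+ a :* ((x₂ :+ c :* x₁) :+ b :* (x₁ :+ c :* x₀))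
           := x₃ :+ ((a :+ (b :+ c)) :* x₂ :+ ((a :* (b :+ c) :+ b :* c) :* x₁ :+ a :* (b :* c) :* x₀)))
           refl (- a) (- b) (- c) x₀ x₁ x₂ x₃ ⟩
    x₃ + ((- a + (- b + - c)) * x₂ + ((- a * (- b + - c) + - b * - c) * x₁ + - a * (- b * - c) * x₀))
      ≈⟨ +-congˡ (+-cong (*-congʳ e₁) (+-cong (*-congʳ e₂) (*-congʳ e₃))) ⟩
    x₃ + (- (a + (b + c)) * x₂ + (- - (a * (b + c) + b * c) * x₁ + - (a * (b * c)) * x₀))
      ≈⟨ +-congˡ (+-cong (-‿distribˡ-* _ x₂) (+-cong (-‿distribˡ-* _ x₁) (-‿distribˡ-* _ x₀))) ⟨
    x₃ + (- ((a + (b + c)) * x₂) + (- (- (a * (b + c) + b * c) * x₁) + - (a * (b * c) * x₀)))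
      ≈⟨ +-congˡ (trans (+-congˡ (-‿+-comm _ _)) (-‿+-comm _ _)) ⟩
    x₃ - ((a + (b + c)) * x₂ + (- (a * (b + c) + b * c) * x₁ + a * (b * c) * x₀)) ∎
    where
    x₀ = f i
    x₁ = f (+ s ℤ.+ i)
    x₂ = f (+ s ℤ.+ (+ s ℤ.+ i))
    x₃ = f (+ s ℤ.+ (+ s ℤ.+ (+ s ℤ.+ i)))
    e₁ : - a + (- b + - c) ≈ - (a + (b + c))
    e₁ = trans (+-congˡ (-‿+-comm b c)) (-‿+-comm a (b + c))
    e₂ : - a * (- b + - c) + - b * - c ≈ - - (a * (b + c) + b * c)
    e₂ = trans
      (+-cong (trans (*-congˡ (-‿+-comm b c)) (-x*-y≈x*y a (b + c))) (-x*-y≈x*y b c))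
      (sym (-‿involutive _))
    e₃ : - a * (- b * - c) ≈ - (a * (b * c))
    e₃ = trans (*-congˡ (-x*-y≈x*y b c)) (sym (-‿distribˡ-* a (b * c)))

  -- The coefficients are, up to sign, the elementary symmetric functions of the characteristic
  -- roots. Passing from step 1 to step r thus replaces each root by its r-th power.
  recurrence-power : ∀ a b c f →
    (∀ i → f (+ 1 ℤ.+ (+ 1 ℤ.+ (+ 1 ℤ.+ i))) ≈
      (a + (b + c)) * f (+ 1 ℤ.+ (+ 1 ℤ.+ i)) +
      (- (a * (b + c) + b * c) * f (+ 1 ℤ.+ i) + a * (b * c) * f i)) →
    ∀ r i → f (+ r ℤ.+ (+ r ℤ.+ (+ r ℤ.+ i))) ≈
      (a ^ r + (b ^ r + c ^ r)) * f (+ r ℤ.+ (+ r ℤ.+ i)) +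
      (- (a ^ r * (b ^ r + c ^ r) + b ^ r * c ^ r) * f (+ r ℤ.+ i) +
       a ^ r * (b ^ r * c ^ r) * f i)
  recurrence-power a b c f rec r i = x-y≈0⇒x≈y (trans
    (sym (Δ³-expand (a ^ r) (b ^ r) (c ^ r) r f i))
    (Δ³-power (λ i → trans (Δ³-expand a b c 1 f i) (x≈y⇒x-y≈0 (rec i))) r i))

-- Third order recurrences and finite sums in a commutative ring.

module LinearRecurrences {c ℓ} (R : CommutativeRing c ℓ) where
  open CommutativeRing R
  open Algebra.Solver.Ring.NaturalCoefficients.Default commutativeSemiring
  open Algebra.Properties.Semiring.Sum semiring

  scale-recurrence : ∀ a b c p {w x y z} → w ≈ a * x + (b * y + c * z) →
    p * w ≈ a * (p * x) + (b * (p * y) + c * (p * z))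
  scale-recurrence a b c p {w} {x} {y} {z} eq = trans (*-congˡ eq)
    (solve 7 (λ a b c p x y z → p :* (a :* x :+ (b :* y :+ c :* z))
        := a :* (p :* x) :+ (b :* (p :* y) :+ c :* (p :* z))) refl a b c p x y z)

  add-recurrence : ∀ a b c {w x y z w′ x′ y′ z′} →
    w ≈ a * x + (b * y + c * z) → w′ ≈ a * x′ + (b * y′ + c * z′) →
    w + w′ ≈ a * (x + x′) + (b * (y + y′) + c * (z + z′))
  add-recurrence a b c {w} {x} {y} {z} {w′} {x′} {y′} {z′} eq eq′ = trans (+-cong eq eq′)
    (solve 9 (λ a b c x y z x′ y′ z′ →
       (a :* x :+ (b :* y :+ c :* z)) :+ (a :* x′ :+ (b :* y′ :+ c :* z′))
       := a :* (x :+ x′) :+ (b :* (y :+ y′) :+ c :* (z :+ z′))) refl a b c x y z x′ y′ z′)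

  -- Entrywise form of p(AX) + q(AY) = A(pX + qY), with `a` a row of A and `x`, `y` columns of X and
  -- Y.
  *-sum-linear : ∀ {d} p q (a x y : Fin d → Carrier) →
    p * sum (λ k → a k * x k) + q * sum (λ k → a k * y k) ≈
    sum (λ k → a k * (p * x k + q * y k))
  *-sum-linear p q a x y = trans
    (+-cong (*-distribˡ-sum p (λ k → a k * x k)) (*-distribˡ-sum q (λ k → a k * y k)))
    (trans (sym (∑-distrib-+ (λ k → p * (a k * x k)) (λ k → q * (a k * y k))))
      (sum-cong-≋ (λ k → solve 5 (λ p q a x y → p :* (a :* x) :+ q :* (a :* y)
         := a :* (p :* x :+ q :* y)) refl p q (a k) (x k) (y k))))

  -- For partial sums: the increments obey the homogeneous recurrence, so the constant `v` is
  -- carried along unchanged.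
  add-sum-recurrence : ∀ a b c {v w x y z w′ x′ y′ z′} →
    w ≈ v + (a * x + (b * y + c * z)) → w′ ≈ a * x′ + (b * y′ + c * z′) →
    w + w′ ≈ v + (a * (x + x′) + (b * (y + y′) + c * (z + z′)))
  add-sum-recurrence a b c {v} eq eq′ = trans (+-cong eq eq′)
    (trans (+-assoc v _ _) (+-congˡ (add-recurrence a b c refl refl)))

  -- The left side is what `sum` unfolds to for the second row of `A r` against a column.
  append-zero : ∀ a b c v x y z →
    1# * v + (a * x + (b * y + (c * z + 0#))) ≈ v + (a * x + (b * y + c * z))
  append-zero = solve 7 (λ a b c v x y z →
    con 1 :* v :+ (a :* x :+ (b :* y :+ (c :* z :+ con 0))) := v :+ (a :* x :+ (b :* y :+ c :* z))) refl

  initial-sum : ∀ a b c x y → x + (a * x + y) ≈ x + y + (a * x + (b * 0# + c * 0#))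
  initial-sum = solve 5 (λ a b c x y →
    x :+ (a :* x :+ y) := x :+ y :+ (a :* x :+ (b :* con 0 :+ c :* con 0))) refl

  x*1+y*0≈x : ∀ x y → x * 1# + y * 0# ≈ x
  x*1+y*0≈x = solve 2 (λ x y → x :* con 1 :+ y :* con 0 := x) refl

  x*0+y*1≈y : ∀ x y → x * 0# + y * 1# ≈ y
  x*0+y*1≈y = solve 2 (λ x y → x :* con 0 :+ y :* con 1 := y) refl

  x*0+y*0≈0 : ∀ x y → x * 0# + y * 0# ≈ 0#
  x*0+y*0≈0 = solve 2 (λ x y → x :* con 0 :+ y :* con 0 := con 0) refl

open import Defs
open import Relation.Binary.PropositionalEquality using (refl; sym; trans; isEquivalence)

-- The commutative ring structure of ℚ(√-3).

ℚ[√-3]-commutativeRing : CommutativeRing 0ℓ 0ℓ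
ℚ[√-3]-commutativeRing = record
  { Carrier = ℚ[√-3] ; _≈_ = _≡_ ; _+_ = _+_ ; _*_ = _*_ ; -_ = -_ ; 0# = 0# ; 1# = 1#
  ; isCommutativeRing = record
    { isRing = record
      { +-isAbelianGroup = record
        { isGroup = record
          { isMonoid = record
            { isSemigroup = record
              { isMagma = record { isEquivalence = isEquivalence ; ∙-cong = cong₂ _+_ }
              ; assoc = λ (a + b √-3) (c + d √-3) (e + f √-3) →
                  cong₂ _+_√-3 (ℚ.+-assoc a c e) (ℚ.+-assoc b d f)
              }
            ; identity = (λ (a + b √-3) → cong₂ _+_√-3 (ℚ.+-identityˡ a) (ℚ.+-identityˡ b))
                       , (λ (a + b √-3) → cong₂ _+_√-3 (ℚ.+-identityʳ a) (ℚ.+-identityʳ b))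
            }
          ; inverse = (λ (a + b √-3) → cong₂ _+_√-3 (ℚ.+-inverseˡ a) (ℚ.+-inverseˡ b))
                    , (λ (a + b √-3) → cong₂ _+_√-3 (ℚ.+-inverseʳ a) (ℚ.+-inverseʳ b))
          ; ⁻¹-cong = cong -_
          }
        ; comm = λ (a + b √-3) (c + d √-3) → cong₂ _+_√-3 (ℚ.+-comm a c) (ℚ.+-comm b d)
        }
      ; *-cong = cong₂ _*_
      ; *-assoc = *-assoc
      ; *-identity = *-identityˡ , λ x → trans (*-comm x 1#) (*-identityˡ x)
      ; distrib = *-distribˡ-+ , λ x y z → trans (*-comm (y + z) x)
          (trans (*-distribˡ-+ x y z) (cong₂ _+_ (*-comm x y) (*-comm x z)))
      }
    ; *-comm = *-comm
    }
  }
  where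
  open ℚ.+-*-Solver

  -- Passed to the solver as a variable `t`: the ring laws hold whatever the value of the adjoined
  -- square.
  3ℚ : ℚ
  3ℚ = + 3 ℚ./ 1

  *-comm : ∀ x y → x * y ≡ y * x
  *-comm (a + b √-3) (c + d √-3) = cong₂ _+_√-3
    (cong₂ (λ u v → u ℚ.- 3ℚ ℚ.* v) (ℚ.*-comm a c) (ℚ.*-comm b d))
    (trans (ℚ.+-comm (a ℚ.* d) (b ℚ.* c)) (cong₂ ℚ._+_ (ℚ.*-comm b c) (ℚ.*-comm a d)))

  *-identityˡ : ∀ x → 1# * x ≡ x
  *-identityˡ (a + b √-3) = cong₂ _+_√-3
    (solve 3 (λ t a b → con 1ℚ :* a :- t :* (con 0ℚ :* b) := a) refl 3ℚ a b)
    (solve 2 (λ a b → con 1ℚ :* b :+ con 0ℚ :* a := b) refl a b)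

  *-distribˡ-+ : ∀ x y z → x * (y + z) ≡ x * y + x * z
  *-distribˡ-+ (a + b √-3) (c + d √-3) (e + f √-3) = cong₂ _+_√-3
    (solve 7 (λ t a b c d e f → a :* (c :+ e) :- t :* (b :* (d :+ f))
      := (a :* c :- t :* (b :* d)) :+ (a :* e :- t :* (b :* f))) refl 3ℚ a b c d e f)
    (solve 6 (λ a b c d e f → a :* (d :+ f) :+ b :* (c :+ e)
      := (a :* d :+ b :* c) :+ (a :* f :+ b :* e)) refl a b c d e f)

  *-assoc : ∀ x y z → (x * y) * z ≡ x * (y * z)
  *-assoc (a + b √-3) (c + d √-3) (e + f √-3) = cong₂ _+_√-3
    (solve 7 (λ t a b c d e f →
      (a :* c :- t :* (b :* d)) :* e :- t :* ((a :* d :+ b :* c) :* f)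
      := a :* (c :* e :- t :* (d :* f)) :- t :* (b :* (c :* f :+ d :* e))) refl 3ℚ a b c d e f)
    (solve 7 (λ t a b c d e f →
      (a :* c :- t :* (b :* d)) :* f :+ (a :* d :+ b :* c) :* e
      := a :* (c :* f :+ d :* e) :+ b :* (c :* e :- t :* (d :* f))) refl 3ℚ a b c d e f)

open CommutativeRing ℚ[√-3]-commutativeRing
  using (+-assoc; +-identityˡ; +-identityʳ; *-identityˡ; *-identityʳ; *-comm; zeroˡ; zeroʳ;
         semiring; commutativeSemiring)
open ≡-Reasoning
open Algebra.Properties.CommutativeSemiring.Exp commutativeSemiring using (^-distrib-*)
open Algebra.Properties.Semiring.Sum semiring using (sum-init-last; sum-cong-≗; sum-replicate-zero)
open DifferenceOperators ℚ[√-3]-commutativeRing using (recurrence-power)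
open LinearRecurrences ℚ[√-3]-commutativeRing

-- The recurrence of J at all integers and its characteristic roots.

jacobsthal-recurrence : ∀ i → jacobsthal (+ 3 ℤ.+ i) ≡
  jacobsthal (+ 2 ℤ.+ i) ℚ.+ jacobsthal (+ 1 ℤ.+ i) ℚ.+ (+ 2 ℚ./ 1) ℚ.* jacobsthal i
jacobsthal-recurrence (+ n)                    = refl
-- For i = -1, -2, -3 the indices straddle both branches of `jacobsthal`, and the values are
-- compared by computation.
jacobsthal-recurrence -[1+ 0 ]                 = refl
jacobsthal-recurrence -[1+ 1 ]                 = refl
jacobsthal-recurrence -[1+ 2 ]                 = refl
-- From -4 downwards all four indices are negative, and the backward definition is solved for its
-- leading term.
jacobsthal-recurrence -[1+ suc (suc (suc k)) ] =
  solve 3 (λ x y z → x := y :+ z :+ con (+ 2 ℚ./ 1) :* (con ½ :* (x :- y :- z))) refl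
    (jacobsthal⁻ (3 ℕ.+ k)) (jacobsthal⁻ (4 ℕ.+ k)) (jacobsthal⁻ (5 ℕ.+ k))
  where open ℚ.+-*-Solver

-- Addition needs no such lemma: the irrational part `0ℚ ℚ.+ 0ℚ` evaluates to `0ℚ`.
ι-* : ∀ p q → ι (p ℚ.* q) ≡ ι p * ι q
ι-* p q = cong₂ _+_√-3
  (solve 3 (λ t p q → p :* q := p :* q :- t :* (con 0ℚ :* con 0ℚ)) refl (+ 3 ℚ./ 1) p q)
  (solve 2 (λ p q → con 0ℚ := p :* con 0ℚ :+ con 0ℚ :* q) refl p q)
  where open ℚ.+-*-Solver

-- J_{rk} has characteristic polynomial x³ − trace x² − minors x − determinant,
-- so minors is minus the sum of the principal 2 × 2 minors.
trace minors determinant : ℕ → ℚ[√-3]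
trace       r = 2# ^ r + ε r
minors      r = - (2# ^ r * ε r + 1#)
determinant r = 2# ^ r

1^n≡1 : ∀ n → 1# ^ n ≡ 1#
1^n≡1 zero    = refl
1^n≡1 (suc n) = trans (*-identityˡ (1# ^ n)) (1^n≡1 n)

-- The product `ω₁ * ω₂` evaluates to `1#`, so only a power of one remains.
ω₁^r*ω₂^r≡1 : ∀ r → ω₁ ^ r * ω₂ ^ r ≡ 1#
ω₁^r*ω₂^r≡1 r = trans (sym (^-distrib-* ω₁ ω₂ r)) (1^n≡1 r)

J-recurrence₁ : ∀ i → J (+ 1 ℤ.+ (+ 1 ℤ.+ (+ 1 ℤ.+ i))) ≡
  (2# + (ω₁ + ω₂)) * J (+ 1 ℤ.+ (+ 1 ℤ.+ i)) +
  (- (2# * (ω₁ + ω₂) + ω₁ * ω₂) * J (+ 1 ℤ.+ i) + 2# * (ω₁ * ω₂) * J i)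
J-recurrence₁ i = begin
  J (+ 1 ℤ.+ (+ 1 ℤ.+ (+ 1 ℤ.+ i)))
    ≡⟨ cong J (shift₃ i) ⟩
  J (+ 3 ℤ.+ i)
    ≡⟨ cong ι (jacobsthal-recurrence i) ⟩
  J (+ 2 ℤ.+ i) + J (+ 1 ℤ.+ i) + ι ((+ 2 ℚ./ 1) ℚ.* jacobsthal i)
    ≡⟨ cong (λ x → J (+ 2 ℤ.+ i) + J (+ 1 ℤ.+ i) + x) (ι-* (+ 2 ℚ./ 1) (jacobsthal i)) ⟩
  J (+ 2 ℤ.+ i) + J (+ 1 ℤ.+ i) + 2# * J i
    ≡⟨ +-assoc (J (+ 2 ℤ.+ i)) (J (+ 1 ℤ.+ i)) (2# * J i) ⟩
  J (+ 2 ℤ.+ i) + (J (+ 1 ℤ.+ i) + 2# * J i)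
    ≡⟨ cong₂ (λ x y → x + (y + 2# * J i)) (*-identityˡ (J (+ 2 ℤ.+ i))) (*-identityˡ (J (+ 1 ℤ.+ i))) ⟨
  1# * J (+ 2 ℤ.+ i) + (1# * J (+ 1 ℤ.+ i) + 2# * J i)
    ≡⟨ cong (λ j → 1# * J j + (1# * J (+ 1 ℤ.+ i) + 2# * J i)) (shift₂ i) ⟨
  -- The symmetric functions of `2#`, `ω₁`, `ω₂` evaluate to the coefficients 1, 1, 2, so this line
  -- is the goal by computation.
  1# * J (+ 1 ℤ.+ (+ 1 ℤ.+ i)) + (1# * J (+ 1 ℤ.+ i) + 2# * J i) ∎
  where
  shift₂ : ∀ i → + 1 ℤ.+ (+ 1 ℤ.+ i) ≡ + 2 ℤ.+ i
  shift₂ = ℤ.solve-∀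
  shift₃ : ∀ i → + 1 ℤ.+ (+ 1 ℤ.+ (+ 1 ℤ.+ i)) ≡ + 3 ℤ.+ i
  shift₃ = ℤ.solve-∀

-- Sequences obeying the recurrence of J along multiples of r.

Recurrent : ℕ → (ℤ → ℚ[√-3]) → Set
Recurrent r u = ∀ k → u (k ℤ.+ + 1) ≡
  trace r * u k + (minors r * u (k ℤ.- + 1) + determinant r * u (k ℤ.- + 2))

-- This is `recurrence-power` based at the index r(k - 2), which three shifts by r carry to r(k +
-- 1). The relation ω₁ʳω₂ʳ = 1 then simplifies the last two coefficients.
J-recurrent : ∀ r → Recurrent r (λ k → J (+ r ℤ.* k))
J-recurrent r k = begin
  J (+ r ℤ.* (k ℤ.+ + 1))
    ≡⟨ cong J (shift₃ (+ r) k) ⟩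
  J (+ r ℤ.+ (+ r ℤ.+ (+ r ℤ.+ i)))
    ≡⟨ recurrence-power 2# ω₁ ω₂ J J-recurrence₁ r i ⟩
  trace r * J (+ r ℤ.+ (+ r ℤ.+ i)) +
  (- (2# ^ r * ε r + ω₁ ^ r * ω₂ ^ r) * J (+ r ℤ.+ i) + 2# ^ r * (ω₁ ^ r * ω₂ ^ r) * J i)
    ≡⟨ cong (λ x → trace r * J (+ r ℤ.+ (+ r ℤ.+ i)) +
                   (- (2# ^ r * ε r + x) * J (+ r ℤ.+ i) + 2# ^ r * x * J i))
            (ω₁^r*ω₂^r≡1 r) ⟩
  trace r * J (+ r ℤ.+ (+ r ℤ.+ i)) + (minors r * J (+ r ℤ.+ i) + 2# ^ r * 1# * J i)
    ≡⟨ cong (λ x → trace r * J (+ r ℤ.+ (+ r ℤ.+ i)) + (minors r * J (+ r ℤ.+ i) + x * J i))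
            (*-identityʳ (2# ^ r)) ⟩
  trace r * J (+ r ℤ.+ (+ r ℤ.+ i)) + (minors r * J (+ r ℤ.+ i) + determinant r * J i)
    ≡⟨ cong₂ (λ x y → trace r * J x + (minors r * J y + determinant r * J i))
             (shift₂ (+ r) k) (shift₁ (+ r) k) ⟩
  trace r * J (+ r ℤ.* k) + (minors r * J (+ r ℤ.* (k ℤ.- + 1)) + determinant r * J i) ∎
  where
  i = + r ℤ.* (k ℤ.- + 2)
  shift₁ : ∀ s k → s ℤ.+ s ℤ.* (k ℤ.- + 2) ≡ s ℤ.* (k ℤ.- + 1)
  shift₁ = ℤ.solve-∀
  shift₂ : ∀ s k → s ℤ.+ (s ℤ.+ s ℤ.* (k ℤ.- + 2)) ≡ s ℤ.* k
  shift₂ = ℤ.solve-∀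
  shift₃ : ∀ s k → s ℤ.* (k ℤ.+ + 1) ≡ s ℤ.+ (s ℤ.+ (s ℤ.+ s ℤ.* (k ℤ.- + 2)))
  shift₃ = ℤ.solve-∀

recurrent-shift : ∀ r {u} → Recurrent r u → ∀ d → Recurrent r (λ k → u (k ℤ.+ d))
recurrent-shift r {u} rec d k = begin
  u (k ℤ.+ + 1 ℤ.+ d)
    ≡⟨ cong u (swap k (+ 1) d) ⟩
  u (k ℤ.+ d ℤ.+ + 1)
    ≡⟨ rec (k ℤ.+ d) ⟩
  trace r * u (k ℤ.+ d) +
  (minors r * u (k ℤ.+ d ℤ.- + 1) + determinant r * u (k ℤ.+ d ℤ.- + 2))
    ≡⟨ cong₂ (λ x y → trace r * u (k ℤ.+ d) + (minors r * u x + determinant r * u y))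
             (swap k d (ℤ.- + 1)) (swap k d (ℤ.- + 2)) ⟩
  trace r * u (k ℤ.+ d) +
  (minors r * u (k ℤ.- + 1 ℤ.+ d) + determinant r * u (k ℤ.- + 2 ℤ.+ d)) ∎
  where
  swap : ∀ x y z → x ℤ.+ y ℤ.+ z ≡ x ℤ.+ z ℤ.+ y
  swap = ℤ.solve-∀

recurrent-scale : ∀ r {u} p → Recurrent r u → Recurrent r (λ k → p * u k)
recurrent-scale r p rec k = scale-recurrence (trace r) (minors r) (determinant r) p (rec k)

-- `K r` is a fixed linear combination of J_{rk} and its shift J_{r(k-1)}, and solutions of the
-- recurrence are closed under both operations.
K-recurrent : ∀ r → Recurrent r (K r)
K-recurrent r k = add-recurrence (trace r) (minors r) (determinant r)
  (recurrent-scale r (minors r) (J-recurrent r) k)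
  (recurrent-scale r (2# ^ r) (recurrent-shift r (J-recurrent r) (ℤ.- + 1)) k)

-- Values of J at small multiples of r.

J[r*0]≡0 : ∀ r → J (+ r ℤ.* + 0) ≡ 0#
J[r*0]≡0 r = cong J (ℤ.*-zeroʳ (+ r))

J[r*1]≡J[r] : ∀ r → J (+ r ℤ.* + 1) ≡ J (+ r)
J[r*1]≡J[r] r = cong J (ℤ.*-identityʳ (+ r))

J[r*-1]≡J[-r] : ∀ r → J (+ r ℤ.* (ℤ.- + 1)) ≡ J (ℤ.- + r)
J[r*-1]≡J[-r] r = cong J (trans (ℤ.*-comm (+ r) (ℤ.- + 1)) (ℤ.-1*i≡-i (+ r)))

-- The recurrence at k = 1, where the middle term vanishes because J_0 = 0.
J[2r] : ∀ r → J (+ r ℤ.* + 2) ≡ trace r * J (+ r) + 2# ^ r * J (ℤ.- + r)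
J[2r] r = begin
  J (+ r ℤ.* + 2)
    ≡⟨ J-recurrent r (+ 1) ⟩
  trace r * J (+ r ℤ.* + 1) + (minors r * J (+ r ℤ.* + 0) + 2# ^ r * J (+ r ℤ.* (ℤ.- + 1)))
    ≡⟨ cong₂ (λ x y → trace r * x + (minors r * y + 2# ^ r * J (+ r ℤ.* (ℤ.- + 1))))
             (J[r*1]≡J[r] r) (J[r*0]≡0 r) ⟩
  trace r * J (+ r) + (minors r * 0# + 2# ^ r * J (+ r ℤ.* (ℤ.- + 1)))
    ≡⟨ cong₂ (λ x y → trace r * J (+ r) + (x + 2# ^ r * y)) (zeroʳ (minors r)) (J[r*-1]≡J[-r] r) ⟩
  trace r * J (+ r) + (0# + 2# ^ r * J (ℤ.- + r))
    ≡⟨ cong (λ x → trace r * J (+ r) + x) (+-identityˡ (2# ^ r * J (ℤ.- + r))) ⟩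
  trace r * J (+ r) + 2# ^ r * J (ℤ.- + r) ∎

-- Partial sums and their inhomogeneous recurrence.

S-zero : ∀ r → S r 0 ≡ 0#
S-zero r = trans (+-identityʳ (J (+ r ℤ.* + 0))) (J[r*0]≡0 r)

S-suc : ∀ r m → S r (suc m) ≡ S r m + J (+ r ℤ.* + suc m)
S-suc r m = trans (sum-init-last (λ k → J (+ r ℤ.* + toℕ {suc (suc m)} k)))
  (cong₂ _+_ (sum-cong-≗ {suc m} (λ k → cong (λ n → J (+ r ℤ.* + n)) (toℕ-inject₁ k)))
             (cong (λ n → J (+ r ℤ.* + n)) (toℕ-fromℕ (suc m))))

S-one : ∀ r → S r 1 ≡ J (+ r)
S-one r = trans (S-suc r 0)
  (trans (cong₂ _+_ (S-zero r) (J[r*1]≡J[r] r)) (+-identityˡ (J (+ r))))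

-- Truncated subtraction is harmless at m = 0, since the added term J_0 is zero.
S-pred : ∀ r m → S r m ≡ S r (m ∸ 1) + J (+ r ℤ.* + m)
S-pred r zero    = sym (trans (cong (λ x → S r 0 + x) (J[r*0]≡0 r)) (+-identityʳ (S r 0)))
S-pred r (suc m) = S-suc r m

-- Induction on m: each step adds an instance of the recurrence for J, so the constant is determined
-- at m = 0. It is the corner entry of `Q`.
S-recurrence : ∀ r m → S r (2 ℕ.+ m) ≡ (J (+ r) + 2# ^ r * J (ℤ.- + r)) +
  (trace r * S r (suc m) + (minors r * S r m + determinant r * S r (m ∸ 1)))
S-recurrence r zero = begin
  S r 2
    ≡⟨ S-suc r 1 ⟩
  S r 1 + J (+ r ℤ.* + 2)
    ≡⟨ cong₂ _+_ (S-one r) (J[2r] r) ⟩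
  J (+ r) + (trace r * J (+ r) + 2# ^ r * J (ℤ.- + r))
    ≡⟨ initial-sum (trace r) (minors r) (determinant r) (J (+ r)) (2# ^ r * J (ℤ.- + r)) ⟩
  (J (+ r) + 2# ^ r * J (ℤ.- + r)) + (trace r * J (+ r) + (minors r * 0# + determinant r * 0#))
    ≡⟨ cong₂ (λ x y → (J (+ r) + 2# ^ r * J (ℤ.- + r)) +
                      (trace r * x + (minors r * y + determinant r * y)))
             (S-one r) (S-zero r) ⟨
  (J (+ r) + 2# ^ r * J (ℤ.- + r)) +
  (trace r * S r 1 + (minors r * S r 0 + determinant r * S r 0)) ∎
S-recurrence r (suc m) = begin
  S r (3 ℕ.+ m)
    ≡⟨ S-suc r (2 ℕ.+ m) ⟩
  S r (2 ℕ.+ m) + J (+ r ℤ.* + (3 ℕ.+ m))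
    ≡⟨ add-sum-recurrence (trace r) (minors r) (determinant r)
         {v = J (+ r) + 2# ^ r * J (ℤ.- + r)} {x = S r (suc m)} {y = S r m} {z = S r (m ∸ 1)}
         (S-recurrence r m) rec ⟩
  (J (+ r) + 2# ^ r * J (ℤ.- + r)) +
  (trace r * (S r (suc m) + J (+ r ℤ.* + (2 ℕ.+ m))) +
   (minors r * (S r m + J (+ r ℤ.* + suc m)) + determinant r * (S r (m ∸ 1) + J (+ r ℤ.* + m))))
    ≡⟨ cong₂ (λ x y → (J (+ r) + 2# ^ r * J (ℤ.- + r)) + (trace r * x + y))
         (S-suc r (suc m))
         (cong₂ (λ x y → minors r * x + determinant r * y) (S-suc r m) (S-pred r m)) ⟨
  (J (+ r) + 2# ^ r * J (ℤ.- + r)) +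
  (trace r * S r (2 ℕ.+ m) + (minors r * S r (suc m) + determinant r * S r m)) ∎
  where
  rec : J (+ r ℤ.* + (3 ℕ.+ m)) ≡ trace r * J (+ r ℤ.* + (2 ℕ.+ m)) +
    (minors r * J (+ r ℤ.* + suc m) + determinant r * J (+ r ℤ.* + m))
  rec = trans (cong (λ n → J (+ r ℤ.* + n)) (ℕ.+-comm 1 (2 ℕ.+ m))) (J-recurrent r (+ (2 ℕ.+ m)))

-- Left multiplication of Q by A.

sum-zero : ∀ {d} (x : Vector ℚ[√-3] d) → (∀ k → x k ≡ 0#) → sum x ≡ 0#
sum-zero {d} x x≡0 = trans (sum-cong-≗ x≡0) (sum-replicate-zero d)

sum-𝟙ˡ : ∀ {d} i (x : Vector ℚ[√-3] d) → sum (λ k → 𝟙 i k * x k) ≡ x i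
sum-𝟙ˡ zero x = trans
  (cong₂ _+_ (*-identityˡ (x zero)) (sum-zero _ (λ k → zeroˡ (x (suc k)))))
  (+-identityʳ (x zero))
sum-𝟙ˡ (suc i) x = trans
  (cong₂ _+_ (zeroˡ (x zero)) (sum-𝟙ˡ i (λ k → x (suc k))))
  (+-identityˡ (x (suc i)))

sum-𝟙ʳ : ∀ {d} (x : Vector ℚ[√-3] d) j → sum (λ k → x k * 𝟙 k j) ≡ x j
sum-𝟙ʳ x zero = trans
  (cong₂ _+_ (*-identityʳ (x zero)) (sum-zero _ (λ k → zeroʳ (x (suc k)))))
  (+-identityʳ (x zero))
sum-𝟙ʳ x (suc j) = trans
  (cong₂ _+_ (zeroʳ (x zero)) (sum-𝟙ʳ (λ k → x (suc k)) j))
  (+-identityˡ (x (suc j)))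

-- Rows `0F`, `2F`, `3F` of `A r` are rows `0F`, `1F`, `2F` of the identity and merely copy rows of
-- `Q`. Row `1F` applies the recurrence, with the top row of `Q` supplying the constant for the
-- sums.
A⊗Q : ∀ r m i j → (A r ⊗ Q r (suc m)) i j ≡ Q r (2 ℕ.+ m) i j
A⊗Q r m 0F j = trans (sum-𝟙ˡ 0F (λ k → Q r (suc m) k j)) (row j)
  where
  row : ∀ j → Q r (suc m) 0F j ≡ Q r (2 ℕ.+ m) 0F j
  row 0F = refl
  row 1F = refl
  row 2F = refl
  row 3F = refl
A⊗Q r m 1F j = trans
  (append-zero (trace r) (minors r) (determinant r)
    (Q r (suc m) 0F j) (Q r (suc m) 1F j) (Q r (suc m) 2F j) (Q r (suc m) 3F j))
  (row j)
  where
  +1 : + suc m ℤ.+ + 1 ≡ + (2 ℕ.+ m)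
  +1 = cong +_ (ℕ.+-comm (suc m) 1)

  -- Outside the first column the top row of `Q` is `0#`, so the recurrence is homogeneous there.
  drop-zero : ∀ {x y} → y ≡ x → 0# + x ≡ y
  drop-zero {x} y≡x = trans (+-identityˡ x) (sym y≡x)

  row : ∀ j → Q r (suc m) 0F j + (trace r * Q r (suc m) 1F j +
    (minors r * Q r (suc m) 2F j + determinant r * Q r (suc m) 3F j)) ≡ Q r (2 ℕ.+ m) 1F j
  row 0F = sym (S-recurrence r m)
  row 1F = drop-zero (trans (J-recurrent r (+ (2 ℕ.+ m)))
    (cong (λ k → trace r * J (+ r ℤ.* k) +
                 (minors r * J (+ r ℤ.* + suc m) + determinant r * J (+ r ℤ.* + m))) (sym +1)))
  row 2F = drop-zero (trans (cong (K r) (sym +1)) (K-recurrent r (+ suc m)))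
  row 3F = drop-zero (trans (cong (λ k → 2# ^ r * J (+ r ℤ.* k)) (sym +1))
    (recurrent-scale r (2# ^ r) (J-recurrent r) (+ suc m)))
A⊗Q r m 2F j = trans (sum-𝟙ˡ 1F (λ k → Q r (suc m) k j)) (row j)
  where
  row : ∀ j → Q r (suc m) 1F j ≡ Q r (2 ℕ.+ m) 2F j
  row 0F = refl
  row 1F = cong (λ n → J (+ r ℤ.* + n)) (ℕ.+-comm (suc m) 1)
  row 2F = refl
  row 3F = refl
A⊗Q r m 3F j = trans (sum-𝟙ˡ 2F (λ k → Q r (suc m) k j)) (row j)
  where
  row : ∀ j → Q r (suc m) 2F j ≡ Q r (2 ℕ.+ m) 3F j
  row 0F = refl
  row 1F = refl
  row 2F = refl
  row 3F = refl

-- The base case n = 1.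

K[0] : ∀ r → K r (+ 0) ≡ 2# ^ r * J (ℤ.- + r)
K[0] r = begin
  minors r * J (+ r ℤ.* + 0) + 2# ^ r * J (+ r ℤ.* (ℤ.- + 1))
    ≡⟨ cong₂ (λ x y → minors r * x + 2# ^ r * y) (J[r*0]≡0 r) (J[r*-1]≡J[-r] r) ⟩
  minors r * 0# + 2# ^ r * J (ℤ.- + r)
    ≡⟨ cong (λ x → x + 2# ^ r * J (ℤ.- + r)) (zeroʳ (minors r)) ⟩
  0# + 2# ^ r * J (ℤ.- + r)
    ≡⟨ +-identityˡ (2# ^ r * J (ℤ.- + r)) ⟩
  2# ^ r * J (ℤ.- + r) ∎

K[1] : ∀ r → K r (+ 1) ≡ minors r * J (+ r)
K[1] r = begin
  minors r * J (+ r ℤ.* + 1) + 2# ^ r * J (+ r ℤ.* + 0)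
    ≡⟨ cong₂ (λ x y → minors r * x + 2# ^ r * y) (J[r*1]≡J[r] r) (J[r*0]≡0 r) ⟩
  minors r * J (+ r) + 2# ^ r * 0#
    ≡⟨ cong (λ x → minors r * J (+ r) + x) (zeroʳ (2# ^ r)) ⟩
  minors r * J (+ r) + 0#
    ≡⟨ +-identityʳ (minors r * J (+ r)) ⟩
  minors r * J (+ r) ∎

-- In the recurrence for J at k = 0 the leading term vanishes, and what remains is `K r (ℤ.- + 1)`
-- by definition.
K[-1] : ∀ r → K r (ℤ.- + 1) ≡ J (+ r)
K[-1] r = sym (begin
  J (+ r)
    ≡⟨ J[r*1]≡J[r] r ⟨
  J (+ r ℤ.* + 1)
    ≡⟨ J-recurrent r (+ 0) ⟩
  trace r * J (+ r ℤ.* + 0) + K r (ℤ.- + 1)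
    ≡⟨ cong (λ x → trace r * x + K r (ℤ.- + 1)) (J[r*0]≡0 r) ⟩
  trace r * 0# + K r (ℤ.- + 1)
    ≡⟨ cong (λ x → x + K r (ℤ.- + 1)) (zeroʳ (trace r)) ⟩
  0# + K r (ℤ.- + 1)
    ≡⟨ +-identityˡ (K r (ℤ.- + 1)) ⟩
  K r (ℤ.- + 1) ∎)

JA⊕𝟙 : ∀ r i j → J (+ r) * A r i j + (2# ^ r * J (ℤ.- + r)) * 𝟙 i j ≡ Q r 1 i j
JA⊕𝟙 r = entry
  where
  p = J (+ r)
  q = 2# ^ r * J (ℤ.- + r)

  2^r*J[r*0]≡0 : 2# ^ r * J (+ r ℤ.* + 0) ≡ 0#
  2^r*J[r*0]≡0 = trans (cong (2# ^ r *_) (J[r*0]≡0 r)) (zeroʳ (2# ^ r))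

  p*x+q*0 : ∀ x → p * x + q * 0# ≡ x * p
  p*x+q*0 x = trans (cong (λ y → p * x + y) (zeroʳ q)) (trans (+-identityʳ (p * x)) (*-comm p x))

  entry : ∀ i j → p * A r i j + q * 𝟙 i j ≡ Q r 1 i j
  entry 0F 0F = cong₂ _+_ (*-identityʳ p) (*-identityʳ q)
  entry 0F 1F = x*0+y*0≈0 p q
  entry 0F 2F = x*0+y*0≈0 p q
  entry 0F 3F = x*0+y*0≈0 p q
  entry 1F 0F = trans (x*1+y*0≈x p q) (sym (S-one r))
  entry 1F 1F = trans (cong₂ _+_ (*-comm p (trace r)) (*-identityʳ q)) (sym (J[2r] r))
  entry 1F 2F = trans (p*x+q*0 (minors r)) (sym (K[1] r))
  entry 1F 3F = trans (p*x+q*0 (2# ^ r)) (cong (2# ^ r *_) (sym (J[r*1]≡J[r] r)))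
  entry 2F 0F = trans (x*0+y*0≈0 p q) (sym (S-zero r))
  entry 2F 1F = trans (x*1+y*0≈x p q) (sym (J[r*1]≡J[r] r))
  entry 2F 2F = trans (x*0+y*1≈y p q) (sym (K[0] r))
  entry 2F 3F = trans (x*0+y*0≈0 p q) (sym 2^r*J[r*0]≡0)
  -- The index 1 ∸ 2 truncates to 0, and `S r 0` has the value zero of the empty sum S_{r,-1}.
  entry 3F 0F = trans (x*0+y*0≈0 p q) (sym (S-zero r))
  entry 3F 1F = trans (x*0+y*0≈0 p q) (sym (J[r*0]≡0 r))
  entry 3F 2F = trans (x*1+y*0≈x p q) (sym (K[-1] r))
  entry 3F 3F = trans (x*0+y*1≈y p q) (cong (2# ^ r *_) (sym (J[r*-1]≡J[-r] r)))

-- The exponent `suc m` lets the induction start at n = 1, where the second power is the identity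
-- matrix.
A-power : ∀ r m i j →
  (J (+ r) · A r ^ᴹ suc m ⊕ (2# ^ r * J (ℤ.- + r)) · A r ^ᴹ m) i j ≡ Q r (suc m) i j
A-power r zero i j = trans
  -- `A r ^ᴹ 1` unfolds to `A r ⊗ 𝟙`, which must first be reduced to `A r`.
  (cong (λ x → J (+ r) * x + 2# ^ r * J (ℤ.- + r) * 𝟙 i j) (sum-𝟙ʳ (A r i) j))
  (JA⊕𝟙 r i j)
A-power r (suc m) i j = begin
  J (+ r) * (A r ⊗ A r ^ᴹ suc m) i j + 2# ^ r * J (ℤ.- + r) * (A r ⊗ A r ^ᴹ m) i j
    -- One factor `A r` is pulled out of both powers, leaving the induction hypothesis inside.
    ≡⟨ *-sum-linear (J (+ r)) (2# ^ r * J (ℤ.- + r)) (A r i)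
         (λ k → (A r ^ᴹ suc m) k j) (λ k → (A r ^ᴹ m) k j) ⟩
  (A r ⊗ (J (+ r) · A r ^ᴹ suc m ⊕ (2# ^ r * J (ℤ.- + r)) · A r ^ᴹ m)) i j
    ≡⟨ sum-cong-≗ (λ k → cong (A r i k *_) (A-power r m k j)) ⟩
  (A r ⊗ Q r (suc m)) i j
    ≡⟨ A⊗Q r m i j ⟩
  Q r (2 ℕ.+ m) i j ∎

theorem1 : ∀ (r : ℕ) → 1 ≤ r →
    ∀ (n : ℕ) → 2 ≤ n →
    ∀ i j →
    (J (+ r) · A r ^ᴹ n ⊕ (2# ^ r * J (ℤ.- + r)) · A r ^ᴹ (n ∸ 1)) i j ≡ Q r n i j
theorem1 r _ (suc m) _ = A-power r m
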